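{- Let $(x_n)_{n\ge 1}$ be a sequence in $[0,1)$ with Poissonian pair correlations. For each integer $n\ge 2$, let $\ell_{n,1}<\cdots<\ell_{n,g(n)}$ be the distinct gap lengths between neighboring elements of $x_1,\ldots,x_n$ on the torus, and let $\varphi_{n,i}$ be the number of gaps of length $\ell_{n,i}$. Then $$\max_{1\le i\le g(n)} \varphi_{n,i}=o(n)\qquad\text{as } n\to\infty,$$ that is, there are no strictly increasing sequence $(n_t)$ of indexes and constant $c>0$ such that, for every $t$, $\varphi_{n_t,i}\ge c\,n_t$ for at least one $i\in\{1,\ldots,g(n_t)\}$.
   Context: The torus is identified with $[0,1)$, and $|\cdot|$ applied to a difference of two points denotes the distance from the nearest integer (so $|z|=\min(z,1-z)$ for $z\in[0,1)$). A sequence $x=(x_n)_{n\ge1}$ in $[0,1)$ has Poissonian pair correlations if for every real $s>0$, $$\lim_{N\to\infty} F_{x,N}(s)=2s,\qquad\text{where } F_{x,N}(s):=\frac1N\#\left\{1\le i\neq j\le N: |x_i-x_j|<\frac sN\right\},$$ the count being over ordered pairs $(i,j)$ with $i\ne j$. Gap lengths: for an integer $N\ge2$, let $\sigma$ be a permutation of $\{1,\ldots,N\}$ with $x_{\sigma(1)}\le\cdots\le x_{\sigma(N)}$, and set $\sigma(N+1):=\sigma(1)$. The set of different gap lengths is $$G(N):=\{r\in[0,1): r=|x_{\sigma(k+1)}-x_{\sigma(k)}|\text{ for some }k=1,\ldots,N\},$$ and $g(N):=\#G(N)$. The elements of $G(N)$ in increasing order are $\ell_{N,1}<\cdots<\ell_{N,g(N)}$,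 and for $i=1,\ldots,g(N)$, $$\varphi_{N,i}:=\#\{j\in\{1,\ldots,N\}: |x_{\sigma(j+1)}-x_{\sigma(j)}|=\ell_{N,i}\}.$$ -}

module Defs where

open import Algebra.Bundles using (CommutativeRing)
open import Algebra.Core using (Op₁; Op₂)
open import Algebra.Structures using (IsCommutativeRing)
import Algebra.Construct.NaturalChoice.Max
import Algebra.Construct.NaturalChoice.Min
import Algebra.Definitions.RawMonoid
open import Data.Bool.Base using (if_then_else_)
open import Data.Fin.Base using (Fin; toℕ)
import Data.Fin.Properties as Fin
open import Data.Fin.Permutation using (Permutation′; _⟨$⟩ʳ_)
open import Data.List.Base
  using (List; length; filter; map; tabulate; lookup; allFin; cartesianProduct; deduplicate)
open import Data.List.Extrema.Nat using (max)
import Data.List.Sort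
open import Data.Nat.Base as ℕ using (ℕ; zero; suc)
open import Data.Nat.DivMod using (_mod_)
open import Data.Product.Base using (∃; _×_; _,_)
open import Level using (0ℓ)
open import Relation.Binary.Bundles using (StrictTotalOrder; DecTotalOrder)
open import Relation.Binary.Core using (Rel)
import Relation.Binary.Properties.StrictTotalOrder
open import Relation.Binary.PropositionalEquality using (_≢_)
open import Relation.Binary.Structures using (IsStrictTotalOrder)
open import Relation.Nullary using (¬_; Dec; does; ¬?; _×-dec_)
open import Relation.Unary using (Pred; Satisfiable)

-- The library has no real numbers, so they enter through their classical
-- characterisation: a Dedekind-complete (hence Archimedean) ordered field,
-- unique up to isomorphism.  The order is classical, i.e. trichotomous with a
-- decision; equality is the field's own _≈_.
record Reals : Set₁ where
  infix  9 _⁻¹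
  infix  8 -_
  infixl 7 _*_
  infixl 6 _+_
  infix  4 _≈_ _<_
  field
    Carrier            : Set
    _≈_ _<_            : Rel Carrier 0ℓ
    _+_ _*_            : Op₂ Carrier
    -_ _⁻¹             : Op₁ Carrier
    0# 1#              : Carrier
    isCommutativeRing  : IsCommutativeRing _≈_ _+_ _*_ -_ 0# 1#
    isStrictTotalOrder : IsStrictTotalOrder _≈_ _<_

  commutativeRing : CommutativeRing 0ℓ 0ℓ
  commutativeRing = record { isCommutativeRing = isCommutativeRing }

  open CommutativeRing commutativeRing public
    using (_-_; +-rawMonoid)

  strictTotalOrder : StrictTotalOrder 0ℓ 0ℓ 0ℓ
  strictTotalOrder = record { isStrictTotalOrder = isStrictTotalOrder }

  open StrictTotalOrder strictTotalOrder public
    using (_≟_; _<?_)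

  decTotalOrder : DecTotalOrder 0ℓ 0ℓ 0ℓ
  decTotalOrder = Relation.Binary.Properties.StrictTotalOrder.decTotalOrder strictTotalOrder

  open DecTotalOrder decTotalOrder public
    using (_≤_; totalOrder)

  open Algebra.Definitions.RawMonoid +-rawMonoid using () renaming (_×_ to _·_)

  fromℕ : ℕ → Carrier
  fromℕ n = n · 1#

  UpperBound : Pred Carrier 0ℓ → Carrier → Set
  UpperBound S b = ∀ x → S x → x ≤ b

  field
    0#≉1#       : ¬ (0# ≈ 1#)
    -- _⁻¹ is total; its value at 0# is unspecified.
    ⁻¹-cong     : ∀ {x y} → x ≈ y → x ⁻¹ ≈ y ⁻¹
    ⁻¹-inverse  : ∀ x → ¬ (x ≈ 0#) → x * x ⁻¹ ≈ 1#
    +-monoˡ-<   : ∀ {x y} z → x < y → x + z < y + z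
    *-positive  : ∀ {x y} → 0# < x → 0# < y → 0# < x * y
    -- Classically a consequence of completeness; a field of the record because
    -- the witness n is not obtainable constructively from it.
    archimedean : ∀ x → ∃ λ n → x < fromℕ n
    complete    : (S : Pred Carrier 0ℓ) → Satisfiable S → ∃ (UpperBound S) →
                  ∃ λ s → UpperBound S s × (∀ b → UpperBound S b → s ≤ b)

  open Algebra.Construct.NaturalChoice.Min totalOrder public using (_⊓_)
  open Algebra.Construct.NaturalChoice.Max totalOrder public using (_⊔_)

  ∣_∣ : Carrier → Carrier
  ∣ x ∣ = x ⊔ - x

  infixl 7 _/ℕ_
  _/ℕ_ : Carrier → ℕ → Carrier
  x /ℕ n = x * fromℕ n ⁻¹

  -- The values a n for finitely many n are irrelevant, in particular at n = 0
  -- where the sequences below involve the unspecified 0# ⁻¹.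
  infix 4 _⟶_
  _⟶_ : (ℕ → Carrier) → Carrier → Set
  a ⟶ l = ∀ ε → 0# < ε → ∃ λ N₀ → ∀ n → N₀ ℕ.≤ n → ∣ a n - l ∣ < ε

  infix 4 _=o[n]
  _=o[n] : (ℕ → ℕ) → Set
  f =o[n] = (λ n → fromℕ (f n) /ℕ n) ⟶ 0#

module Torus (ℝ : Reals) where
  open Reals ℝ

  In[0,1⟩ : Carrier → Set
  In[0,1⟩ x = (0# ≤ x) × (x < 1#)

  -- For x, y ∈ [0,1): the representative in [0,1) of x - y modulo 1.
  infixl 6 _⊖_
  _⊖_ : Op₂ Carrier
  x ⊖ y = if does (x <? y) then x - y + 1# else x - y

  -- For z ∈ [0,1): the distance from z to the nearest integer.
  ‖_‖ : Carrier → Carrier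
  ‖ z ‖ = z ⊓ (1# - z)

  -- Sequences are functions on ℕ whose value at k is the term of index k + 1;
  -- thus i : Fin N stands for the index toℕ i + 1 ∈ {1,…,N}.
  module Sequence (x : ℕ → Carrier) where

    pt : ∀ {N} → Fin N → Carrier
    pt i = x (toℕ i)

    Close : ∀ N → Carrier → Pred (Fin N × Fin N) 0ℓ
    Close N s (i , j) = i ≢ j × (‖ pt i ⊖ pt j ‖ < s /ℕ N)

    close? : ∀ N s (p : Fin N × Fin N) → Dec (Close N s p)
    close? N s (i , j) = ¬? (i Fin.≟ j) ×-dec (‖ pt i ⊖ pt j ‖ <? s /ℕ N)

    F : ℕ → Carrier → Carrier
    F N s = fromℕ (length (filter (close? N s) (cartesianProduct (allFin N) (allFin N)))) /ℕ N

    PoissonianPairCorrelations : Set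
    PoissonianPairCorrelations = ∀ s → 0# < s → (λ N → F N s) ⟶ (fromℕ 2 * s)

    Sorts : ∀ {N} → Permutation′ N → Set
    Sorts {N} σ = ∀ (i j : Fin N) → toℕ i ℕ.≤ toℕ j → pt (σ ⟨$⟩ʳ i) ≤ pt (σ ⟨$⟩ʳ j)

    -- k ↦ k + 1, with N + 1 identified with 1.
    next : ∀ {N} → Fin N → Fin N
    next {suc m} k = suc (toℕ k) mod suc m

    module Gaps {N : ℕ} (σ : Permutation′ N) where

      gap : Fin N → Carrier
      gap k = ‖ pt (σ ⟨$⟩ʳ next k) ⊖ pt (σ ⟨$⟩ʳ k) ‖

      -- The set of gap lengths, listed in increasing order without repetition.
      G : List Carrier
      G = deduplicate _≟_ (sort (tabulate gap))
        where open Data.List.Sort decTotalOrder using (sort)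

      g : ℕ
      g = length G

      ℓ : Fin g → Carrier
      ℓ i = lookup G i

      φ : Fin g → ℕ
      φ i = length (filter (λ k → gap k ≟ ℓ i) (allFin N))

      maxφ : ℕ
      maxφ = max 0 (map φ (allFin g))

{-# OPTIONS --safe #-}
-- If εn of the gaps of x₁,…,xₙ have the same length ℓ, then F n s jumps by at
-- least ε when s crosses nℓ, because neighbouring points form pairs at distance
-- exactly ℓ.  The gaps add up to a bounded amount, so nℓ ≤ 2/ε.  Cover [0, 2/ε]
-- by finitely many intervals [jδ, (j+1)δ] with δ = ε/4.  For large n, every F n (jδ)
-- is within δ of 2jδ, so F n increases by less than 4δ = ε over each interval,
-- a contradiction.
module Submission where

open import Algebra.Bundles using (CommutativeRing)
import Algebra.Construct.NaturalChoice.MaxOp as MaxOp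
import Algebra.Construct.NaturalChoice.MinOp as MinOp
import Algebra.Construct.NaturalChoice.Max as Max
import Algebra.Construct.NaturalChoice.Min as Min
import Algebra.Properties.Monoid.Mult as Mult
import Algebra.Properties.Ring as RingProperties
open import Data.Fin.Base as Fin using (Fin; zero; suc; toℕ; inject₁)
open import Data.Fin.Permutation using (Permutation′; _⟨$⟩ʳ_)
import Data.Fin.Properties as Fin
open import Data.Fin.Relation.Unary.Top using (view; ‵fromℕ; ‵inject₁)
open import Data.List.Base
  using (List; []; _∷_; _++_; length; filter; map; tabulate; lookup; allFin; cartesianProduct)
open import Data.List.Extrema.Nat using (argmax-all)
open import Data.List.Membership.Propositional using (_∈_)
open import Data.List.Membership.Propositional.Properties
open import Data.List.Properties using (length-++; length-map)
open import Data.List.Relation.Binary.Disjoint.Propositional using (Disjoint)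
open import Data.List.Relation.Binary.Subset.Propositional using (_⊆_)
import Data.List.Relation.Unary.All as All
import Data.List.Relation.Unary.All.Properties as All
open import Data.List.Relation.Unary.AllPairs using ([]; _∷_)
open import Data.List.Relation.Unary.Any using (here)
open import Data.List.Relation.Unary.Any.Properties using (lookup-index)
open import Data.List.Relation.Unary.Unique.Propositional using (Unique)
import Data.List.Relation.Unary.Unique.Propositional.Properties as Unique
open import Data.Nat.Base as ℕ using (ℕ; zero; suc; z≤n; s≤s)
import Data.Nat.DivMod as ℕ
import Data.Nat.Properties as ℕ
open import Data.Product.Base using (Σ-syntax; ∃-syntax; ∃; _×_; _,_; proj₁; proj₂)
open import Data.Sum.Base using (inj₁; inj₂)
open import Function.Base using (_∘_; id)
open import Function.Bundles using (Injection)
open import Function.Properties.Inverse using (↔⇒↣)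
open import Relation.Binary.Bundles using (DecTotalOrder; StrictTotalOrder)
open import Relation.Binary.Core using (_Preserves_⟶_)
open import Relation.Binary.Definitions using (tri<; tri≈; tri>)
import Relation.Binary.PropositionalEquality as ≡
open ≡ using (_≡_; _≢_)
open import Relation.Nullary using (¬_; yes; no; contradiction)
open import Relation.Unary using (Pred; Decidable)
open import Defs

-- Counting in finite lists.

module _ {a} {A : Set a} where

  lookup-injective : ∀ {xs : List A} → Unique xs → ∀ {i j} → lookup xs i ≡ lookup xs j → i ≡ j
  lookup-injective (_ ∷ _)   {zero}  {zero}  _  = ≡.refl
  lookup-injective (x∉ ∷ _)  {zero}  {suc j} eq = contradiction eq (All.lookup x∉ (∈-lookup j))
  lookup-injective (x∉ ∷ _)  {suc i} {zero}  eq = contradiction (≡.sym eq) (All.lookup x∉ (∈-lookup i))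
  lookup-injective (_ ∷ xs!) {suc i} {suc j} eq = ≡.cong suc (lookup-injective xs! eq)

  -- Sending a position in `xs` to the position of the same element in `ys` is an injection between
  -- finite index sets, because `xs` has no repetition.
  Unique∧⊆⇒length≤ : ∀ {xs ys : List A} → Unique xs → xs ⊆ ys → length xs ℕ.≤ length ys
  Unique∧⊆⇒length≤ {xs} {ys} xs! xs⊆ys = Fin.injective⇒≤ λ {i} {j} eq → lookup-injective xs!
    (≡.trans (lookup-index (xs⊆ys (∈-lookup i)))
    (≡.trans (≡.cong (lookup ys) eq) (≡.sym (lookup-index (xs⊆ys (∈-lookup j))))))

  -- `inject₁` misses only the top index, so dropping that index loses at most one hit. This is how
  -- the wrap-around gap is set aside.
  length-filter-tabulate-inject₁ : ∀ {p} {P : Pred A p} (P? : Decidable P) m (f : Fin (suc m) → A) →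
    length (filter P? (tabulate f)) ℕ.≤ suc (length (filter P? (tabulate (f ∘ inject₁))))
  length-filter-tabulate-inject₁ P? zero f with P? (f zero)
  ... | yes _ = s≤s z≤n
  ... | no  _ = z≤n
  length-filter-tabulate-inject₁ P? (suc m) f with P? (f zero)
  ... | yes _ = s≤s (length-filter-tabulate-inject₁ P? m (f ∘ suc))
  ... | no  _ = length-filter-tabulate-inject₁ P? m (f ∘ suc)

-- Multiplicities filter indices, while the telescoping bound filters gap values; this passes from
-- one count to the other.
length-filter-allFin : ∀ {a p} {A : Set a} {P : Pred A p} (P? : Decidable P) {n} (f : Fin n → A) →
  length (filter (P? ∘ f) (allFin n)) ≡ length (filter P? (tabulate f))
length-filter-allFin {A = A} P? f = go f id
  where
  -- `allFin n` is `tabulate id`; the induction passes from `h` to `h ∘ suc`, so the index map has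
  -- to be arbitrary.
  go : ∀ {m n} (f : Fin n → A) (h : Fin m → Fin n) →
       length (filter (P? ∘ f) (tabulate h)) ≡ length (filter P? (tabulate (f ∘ h)))
  go {zero}  f h = ≡.refl
  go {suc m} f h with P? (f (h zero))
  ... | yes _ = ≡.cong suc (go f (h ∘ suc))
  ... | no  _ = go f (h ∘ suc)

∈-length-positive : ∀ {a} {A : Set a} {xs : List A} → 0 ℕ.< length xs → ∃ (_∈ xs)
∈-length-positive {xs = x ∷ _} _ = x , here ≡.refl

-- Eventual properties and finite searches in the natural numbers.

eventually-∀< : ∀ {p} {P : ℕ → ℕ → Set p} → (∀ j → ∃[ N ] (∀ n → N ℕ.≤ n → P n j)) →
                ∀ K → ∃[ N ] (∀ n → N ℕ.≤ n → ∀ j → j ℕ.< K → P n j)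
eventually-∀< ev zero = 0 , λ _ _ _ ()
eventually-∀< {P = P} ev (suc K) with ev K | eventually-∀< ev K
... | N₁ , p | N₂ , q = N₁ ℕ.⊔ N₂ , go
  where
  go : ∀ n → N₁ ℕ.⊔ N₂ ℕ.≤ n → ∀ j → j ℕ.< suc K → P n j
  go n N≤n j j<1+K with ℕ.m<1+n⇒m<n∨m≡n j<1+K
  ... | inj₁ j<K    = q n (ℕ.≤-trans (ℕ.m≤n⊔m N₁ N₂) N≤n) j j<K
  ... | inj₂ ≡.refl = p n (ℕ.≤-trans (ℕ.m≤m⊔n N₁ N₂) N≤n)

-- The search runs downwards from `K`, so the switch found is the last one before `K`. It serves to
-- locate a gap length between two consecutive grid points.
first-step : ∀ {p} {P : Pred ℕ p} → Decidable P → ∀ K → ¬ P 0 → P K →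
             ∃[ j ] j ℕ.< K × ¬ P j × P (suc j)
first-step P? zero    ¬P0 PK = contradiction PK ¬P0
first-step P? (suc K) ¬P0 PK with P? K
... | no ¬PK = K , ℕ.n<1+n K , ¬PK , PK
... | yes p  with first-step P? K ¬P0 p
...   | j , j<K , q = j , ℕ.m<n⇒m<1+n j<K , q

strictlyMonotone⇒expansive : ∀ {ν : ℕ → ℕ} → ν Preserves ℕ._<_ ⟶ ℕ._<_ → ∀ n → n ℕ.≤ ν n
strictlyMonotone⇒expansive mono zero    = z≤n
strictlyMonotone⇒expansive mono (suc n) =
  ℕ.≤-<-trans (strictlyMonotone⇒expansive mono n) (mono (ℕ.n<1+n n))

-- Arithmetic of an ordered field.

module Properties (ℝ : Reals) where
  open Reals ℝ
  open CommutativeRing commutativeRing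
    using (ring; commutativeSemiring; +-monoid; +-congˡ; +-congʳ; *-congˡ; *-congʳ
          ; +-comm; +-assoc; *-assoc; *-comm; +-identityˡ; +-identityʳ; *-identityˡ; *-identityʳ
          ; distribʳ; zeroˡ; zeroʳ; -‿inverseʳ; -‿inverseˡ; -‿cong)
  open RingProperties ring using (-‿distribˡ-*; -‿involutive; -0#≈0#)
    renaming (//-rightDividesˡ to x-y+y≈x)
  open Mult +-monoid using (×-homo-+)
  open StrictTotalOrder strictTotalOrder using (compare; strictPartialOrder; <-respˡ-≈; <-respʳ-≈; module Eq)
    renaming (irrefl to <-irrefl; trans to <-trans)
  open DecTotalOrder decTotalOrder using () renaming (refl to ≤-refl; trans to ≤-trans)
  open import Relation.Binary.Reasoning.StrictPartialOrder strictPartialOrder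
  open import Algebra.Solver.Ring.NaturalCoefficients.Default commutativeSemiring
    using (solve; _:+_; _:*_; _:=_; con)

  ≮⇒≥ : ∀ {x y} → ¬ (x < y) → y ≤ x
  ≮⇒≥ {x} {y} x≮y with compare x y
  ... | tri< x<y _ _ = contradiction x<y x≮y
  ... | tri≈ _ x≈y _ = inj₂ (Eq.sym x≈y)
  ... | tri> _ _ y<x = inj₁ y<x

  ≤⇒≯ : ∀ {x y} → x ≤ y → ¬ (y < x)
  ≤⇒≯ (inj₁ x<y) y<x = <-irrefl Eq.refl (<-trans x<y y<x)
  ≤⇒≯ (inj₂ x≈y) y<x = <-irrefl (Eq.sym x≈y) y<x

  ≰⇒> : ∀ {x y} → ¬ (x ≤ y) → y < x
  ≰⇒> {x} {y} x≰y with compare x y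
  ... | tri< x<y _ _ = contradiction (inj₁ x<y) x≰y
  ... | tri≈ _ x≈y _ = contradiction (inj₂ x≈y) x≰y
  ... | tri> _ _ y<x = y<x

  ≤-<-trans : ∀ {x y z} → x ≤ y → y < z → x < z
  ≤-<-trans (inj₁ x<y) y<z = <-trans x<y y<z
  ≤-<-trans (inj₂ x≈y) y<z = <-respˡ-≈ (Eq.sym x≈y) y<z

  +-monoʳ-< : ∀ {x y} z → x < y → z + x < z + y
  +-monoʳ-< {x} {y} z x<y = begin-strict
    z + x ≈⟨ +-comm z x ⟩
    x + z <⟨ +-monoˡ-< z x<y ⟩
    y + z ≈⟨ +-comm y z ⟩
    z + y ∎

  +-monoˡ-≤ : ∀ {x y} z → x ≤ y → x + z ≤ y + z
  +-monoˡ-≤ z (inj₁ x<y) = inj₁ (+-monoˡ-< z x<y)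
  +-monoˡ-≤ z (inj₂ x≈y) = inj₂ (+-congʳ x≈y)

  +-monoʳ-≤ : ∀ {x y} z → x ≤ y → z + x ≤ z + y
  +-monoʳ-≤ z (inj₁ x<y) = inj₁ (+-monoʳ-< z x<y)
  +-monoʳ-≤ z (inj₂ x≈y) = inj₂ (+-congˡ x≈y)

  +-cancelʳ-≤ : ∀ {x y} z → x + z ≤ y + z → x ≤ y
  +-cancelʳ-≤ z x+z≤y+z = ≮⇒≥ λ y<x → ≤⇒≯ x+z≤y+z (+-monoˡ-< z y<x)

  x-y<z⇒x<z+y : ∀ {x y z} → x - y < z → x < z + y
  x-y<z⇒x<z+y {x} {y} {z} x-y<z = begin-strict
    x           ≈⟨ x-y+y≈x y x ⟨
    (x - y) + y <⟨ +-monoˡ-< y x-y<z ⟩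
    z + y       ∎

  x<y⇒0<y-x : ∀ {x y} → x < y → 0# < y - x
  x<y⇒0<y-x {x} {y} x<y = begin-strict
    0#    ≈⟨ -‿inverseʳ x ⟨
    x - x <⟨ +-monoˡ-< (- x) x<y ⟩
    y - x ∎

  x≤y⇒0≤y-x : ∀ {x y} → x ≤ y → 0# ≤ y - x
  x≤y⇒0≤y-x {x} {y} x≤y = begin
    0#    ≈⟨ -‿inverseʳ x ⟨
    x - x ≤⟨ +-monoˡ-≤ (- x) x≤y ⟩
    y - x ∎

  *-monoʳ-<-pos : ∀ {x y z} → 0# < z → x < y → x * z < y * z
  *-monoʳ-<-pos {x} {y} {z} 0<z x<y = begin-strict
    x * z               ≈⟨ +-identityˡ (x * z) ⟨
    0# + x * z          <⟨ +-monoˡ-< (x * z) (*-positive (x<y⇒0<y-x x<y) 0<z) ⟩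
    (y - x) * z + x * z ≈⟨ distribʳ z (y - x) x ⟨
    ((y - x) + x) * z   ≈⟨ *-congʳ (x-y+y≈x x y) ⟩
    y * z               ∎

  *-monoʳ-≤-nonNeg : ∀ {x y z} → 0# ≤ z → x ≤ y → x * z ≤ y * z
  *-monoʳ-≤-nonNeg (inj₁ 0<z) (inj₁ x<y) = inj₁ (*-monoʳ-<-pos 0<z x<y)
  *-monoʳ-≤-nonNeg _          (inj₂ x≈y) = inj₂ (*-congʳ x≈y)
  *-monoʳ-≤-nonNeg {x} {y} {z} (inj₂ 0≈z) (inj₁ _) = inj₂ (begin-equality
    x * z  ≈⟨ *-congˡ 0≈z ⟨
    x * 0# ≈⟨ zeroʳ x ⟩
    0#     ≈⟨ zeroʳ y ⟨
    y * 0# ≈⟨ *-congˡ 0≈z ⟩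
    y * z  ∎)

  *-monoˡ-≤-nonNeg : ∀ {x y z} → 0# ≤ z → x ≤ y → z * x ≤ z * y
  *-monoˡ-≤-nonNeg {x} {y} {z} 0≤z x≤y = begin
    z * x ≈⟨ *-comm z x ⟩
    x * z ≤⟨ *-monoʳ-≤-nonNeg 0≤z x≤y ⟩
    y * z ≈⟨ *-comm y z ⟩
    z * y ∎

  -- If `1#` were negative, `- 1#` would be positive and so would its square `1#`; equality with
  -- `0#` is excluded by `0#≉1#`.
  0<1 : 0# < 1#
  0<1 with compare 0# 1#
  ... | tri< 0<1 _ _ = 0<1
  ... | tri≈ _ 0≈1 _ = contradiction 0≈1 0#≉1#
  ... | tri> _ _ 1<0 = begin-strict
    0#          <⟨ *-positive 0<-1 0<-1 ⟩
    - 1# * - 1# ≈⟨ -‿distribˡ-* 1# (- 1#) ⟨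
    - (1# * - 1#) ≈⟨ -‿cong (*-identityˡ (- 1#)) ⟩
    - (- 1#)    ≈⟨ -‿involutive 1# ⟩
    1#          ∎
    where
    0<-1 : 0# < - 1#
    0<-1 = <-respʳ-≈ (+-identityˡ (- 1#)) (x<y⇒0<y-x 1<0)

  ⁻¹-positive : ∀ {x} → 0# < x → 0# < x ⁻¹
  ⁻¹-positive {x} 0<x with compare 0# (x ⁻¹)
  ... | tri< 0<x⁻¹ _ _ = 0<x⁻¹
  ... | tri≈ _ 0≈x⁻¹ _ = contradiction
    (begin-equality
      0#       ≈⟨ zeroʳ x ⟨
      x * 0#   ≈⟨ *-congˡ 0≈x⁻¹ ⟩
      x * x ⁻¹ ≈⟨ ⁻¹-inverse x (λ x≈0 → <-irrefl (Eq.sym x≈0) 0<x) ⟩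
      1#       ∎) 0#≉1#
  ... | tri> _ _ x⁻¹<0 = contradiction
    (begin-strict
      1#       ≈⟨ ⁻¹-inverse x (λ x≈0 → <-irrefl (Eq.sym x≈0) 0<x) ⟨
      x * x ⁻¹ ≈⟨ *-comm x (x ⁻¹) ⟩
      x ⁻¹ * x <⟨ *-monoʳ-<-pos 0<x x⁻¹<0 ⟩
      0# * x   ≈⟨ zeroˡ x ⟩
      0#       ∎) (≤⇒≯ (inj₁ 0<1))

  x*y*y⁻¹≈x : ∀ x {y} → 0# < y → x * y * y ⁻¹ ≈ x
  x*y*y⁻¹≈x x {y} 0<y = begin-equality
    x * y * y ⁻¹   ≈⟨ *-assoc x y (y ⁻¹) ⟩
    x * (y * y ⁻¹) ≈⟨ *-congˡ (⁻¹-inverse y (λ y≈0 → <-irrefl (Eq.sym y≈0) 0<y)) ⟩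
    x * 1#         ≈⟨ *-identityʳ x ⟩
    x              ∎

  x*y⁻¹*y≈x : ∀ x {y} → 0# < y → x * y ⁻¹ * y ≈ x
  x*y⁻¹*y≈x x {y} 0<y = begin-equality
    x * y ⁻¹ * y   ≈⟨ solve 3 (λ a b c → a :* b :* c := a :* c :* b) Eq.refl x (y ⁻¹) y ⟩
    x * y * y ⁻¹   ≈⟨ x*y*y⁻¹≈x x 0<y ⟩
    x              ∎

  -- The embedding of the natural numbers.

  fromℕ-homo-+ : ∀ m n → fromℕ (m ℕ.+ n) ≈ fromℕ m + fromℕ n
  fromℕ-homo-+ = ×-homo-+ 1#

  0≤fromℕ : ∀ n → 0# ≤ fromℕ n
  0≤fromℕ zero    = ≤-refl
  0≤fromℕ (suc n) = begin
    0#           ≤⟨ 0≤fromℕ n ⟩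
    fromℕ n      ≈⟨ +-identityˡ (fromℕ n) ⟨
    0# + fromℕ n ≤⟨ +-monoˡ-≤ (fromℕ n) (inj₁ 0<1) ⟩
    1# + fromℕ n ∎

  fromℕ-mono-≤ : ∀ {m n} → m ℕ.≤ n → fromℕ m ≤ fromℕ n
  fromℕ-mono-≤ {n = n} z≤n = 0≤fromℕ n
  fromℕ-mono-≤ (s≤s m≤n)   = +-monoʳ-≤ 1# (fromℕ-mono-≤ m≤n)

  0<fromℕ : ∀ {n} → 0 ℕ.< n → 0# < fromℕ n
  0<fromℕ {suc n} _ = begin-strict
    0#           <⟨ 0<1 ⟩
    1#           ≈⟨ +-identityʳ 1# ⟨
    1# + 0#      ≤⟨ +-monoʳ-≤ 1# (0≤fromℕ n) ⟩
    1# + fromℕ n ∎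

  -- Absolute value estimates.

  open Max totalOrder using (maxOperator)
  open Min totalOrder using (minOperator)
  open MaxOp maxOperator using (⊔-sel; x≤x⊔y; x≤y⊔x)
  open MinOp minOperator using (⊓-glb; x⊓y≤x)

  ∣x-y∣<ε⇒x<ε+y : ∀ {x y ε} → ∣ x - y ∣ < ε → x < ε + y
  ∣x-y∣<ε⇒x<ε+y {x} {y} {ε} lt = x-y<z⇒x<z+y (begin-strict
    x - y     ≤⟨ x≤x⊔y (x - y) (- (x - y)) ⟩
    ∣ x - y ∣ <⟨ lt ⟩
    ε         ∎)

  ∣x-y∣<ε⇒y<ε+x : ∀ {x y ε} → ∣ x - y ∣ < ε → y < ε + x
  ∣x-y∣<ε⇒y<ε+x {x} {y} {ε} lt = begin-strict
    y                       ≈⟨ +-identityˡ y ⟨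
    0# + y                  ≈⟨ +-congʳ (-‿inverseˡ (x - y)) ⟨
    (- (x - y) + (x - y)) + y ≈⟨ +-assoc (- (x - y)) (x - y) y ⟩
    - (x - y) + ((x - y) + y) ≈⟨ +-congˡ (x-y+y≈x y x) ⟩
    - (x - y) + x           ≤⟨ +-monoˡ-≤ x (x≤y⊔x (x - y) (- (x - y))) ⟩
    ∣ x - y ∣ + x           <⟨ +-monoˡ-< x lt ⟩
    ε + x                   ∎

  0≤x<ε⇒∣x-0∣<ε : ∀ {x ε} → 0# ≤ x → x < ε → ∣ x - 0# ∣ < ε
  0≤x<ε⇒∣x-0∣<ε {x} {ε} 0≤x x<ε with ⊔-sel (x - 0#) (- (x - 0#))
  ... | inj₁ eq = <-respˡ-≈ (Eq.sym (Eq.trans eq x-0≈x)) x<ε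
    where
    x-0≈x : x - 0# ≈ x
    x-0≈x = Eq.trans (+-congˡ -0#≈0#) (+-identityʳ x)
  -- When the maximum is `- (x - 0#)`, it is at most 0, hence below `ε`.
  ... | inj₂ eq = begin-strict
    ∣ x - 0# ∣    ≈⟨ eq ⟩
    - (x - 0#)    ≈⟨ +-identityʳ (- (x - 0#)) ⟨
    - (x - 0#) + 0#    ≤⟨ +-monoʳ-≤ (- (x - 0#)) 0≤x ⟩
    - (x - 0#) + x     ≈⟨ +-congˡ (x-y+y≈x 0# x) ⟨
    - (x - 0#) + ((x - 0#) + 0#) ≈⟨ +-congˡ (+-identityʳ (x - 0#)) ⟩
    - (x - 0#) + (x - 0#) ≈⟨ -‿inverseˡ (x - 0#) ⟩
    0#            ≤⟨ 0≤x ⟩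
    x             <⟨ x<ε ⟩
    ε             ∎

  -- Telescoping sums.

  module _ (ℓ : Carrier) where

    -- Each increment of `y` is at least `d k`. An increment with `d k ≈ ℓ` pays for one copy of
    -- `ℓ`; the others are bounded below by 0 and discarded.
    multiplicity*ℓ+y₀≤yₘ : ∀ {m} (y : Fin (suc m) → Carrier) (d : Fin m → Carrier) →
      (∀ k → 0# ≤ d k) → (∀ k → d k + y (inject₁ k) ≤ y (suc k)) →
      fromℕ (length (filter (_≟ ℓ) (tabulate d))) * ℓ + y zero ≤ y (Fin.fromℕ m)
    multiplicity*ℓ+y₀≤yₘ {zero}  y d 0≤d d+y≤y = inj₂ (Eq.trans (+-congʳ (zeroˡ ℓ)) (+-identityˡ (y zero)))
    multiplicity*ℓ+y₀≤yₘ {suc m} y d 0≤d d+y≤y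
      with d zero ≟ ℓ | multiplicity*ℓ+y₀≤yₘ (y ∘ suc) (d ∘ suc) (0≤d ∘ suc) (d+y≤y ∘ suc)
    ... | yes d₀≈ℓ | ih = begin
      (1# + c) * ℓ + y zero     ≈⟨ solve 3 (λ c ℓ y → (con 1 :+ c) :* ℓ :+ y := c :* ℓ :+ (ℓ :+ y)) Eq.refl c ℓ (y zero) ⟩
      c * ℓ + (ℓ + y zero)      ≈⟨ +-congˡ (+-congʳ d₀≈ℓ) ⟨
      c * ℓ + (d zero + y zero) ≤⟨ +-monoʳ-≤ (c * ℓ) (d+y≤y zero) ⟩
      c * ℓ + y (suc zero)      ≤⟨ ih ⟩
      y (suc (Fin.fromℕ m))     ∎
      where c = fromℕ (length (filter (_≟ ℓ) (tabulate (d ∘ suc))))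
    ... | no  _    | ih = begin
      c * ℓ + y zero            ≈⟨ +-congˡ (+-identityˡ (y zero)) ⟨
      c * ℓ + (0# + y zero)     ≤⟨ +-monoʳ-≤ (c * ℓ) (+-monoˡ-≤ (y zero) (0≤d zero)) ⟩
      c * ℓ + (d zero + y zero) ≤⟨ +-monoʳ-≤ (c * ℓ) (d+y≤y zero) ⟩
      c * ℓ + y (suc zero)      ≤⟨ ih ⟩
      y (suc (Fin.fromℕ m))     ∎
      where c = fromℕ (length (filter (_≟ ℓ) (tabulate (d ∘ suc))))

  -- Distance on the torus.

  open Torus ℝ

  0≤z≤1⇒0≤‖z‖ : ∀ {z} → 0# ≤ z → z ≤ 1# → 0# ≤ ‖ z ‖
  0≤z≤1⇒0≤‖z‖ 0≤z z≤1 = ⊓-glb 0≤z (x≤y⇒0≤y-x z≤1)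

  module _ {x y} (0≤x<1 : In[0,1⟩ x) (0≤y<1 : In[0,1⟩ y) where

    0≤x⊖y≤1 : 0# ≤ x ⊖ y × x ⊖ y ≤ 1#
    0≤x⊖y≤1 with x <? y
    -- Adding `y` to both sides removes the subtraction; the two bounds become `y ≤ x + 1` and
    -- `x + 1 ≤ 1 + y`.
    ... | yes x<y = +-cancelʳ-≤ y (begin
        0# + y          ≈⟨ +-identityˡ y ⟩
        y               <⟨ proj₂ 0≤y<1 ⟩
        1#              ≈⟨ +-identityˡ 1# ⟨
        0# + 1#         ≤⟨ +-monoˡ-≤ 1# (proj₁ 0≤x<1) ⟩
        x + 1#          ≈⟨ x-y+1+y≈x+1 ⟨
        x - y + 1# + y  ∎)
      , +-cancelʳ-≤ y (begin
        x - y + 1# + y  ≈⟨ x-y+1+y≈x+1 ⟩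
        x + 1#          <⟨ +-monoˡ-< 1# x<y ⟩
        y + 1#          ≈⟨ +-comm y 1# ⟩
        1# + y          ∎)
      where
      x-y+1+y≈x+1 : x - y + 1# + y ≈ x + 1#
      x-y+1+y≈x+1 = begin-equality
        x - y + 1# + y  ≈⟨ solve 3 (λ d e y → d :+ e :+ y := d :+ y :+ e) Eq.refl (x - y) 1# y ⟩
        x - y + y + 1#  ≈⟨ +-congʳ (x-y+y≈x y x) ⟩
        x + 1#          ∎
    ... | no  x≮y = x≤y⇒0≤y-x (≮⇒≥ x≮y) , +-cancelʳ-≤ y (begin
        x - y + y  ≈⟨ x-y+y≈x y x ⟩
        x          <⟨ proj₂ 0≤x<1 ⟩
        1#         ≈⟨ +-identityʳ 1# ⟨
        1# + 0#    ≤⟨ +-monoʳ-≤ 1# (proj₁ 0≤y<1) ⟩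
        1# + y     ∎)

    0≤‖x⊖y‖ : 0# ≤ ‖ x ⊖ y ‖
    0≤‖x⊖y‖ = 0≤z≤1⇒0≤‖z‖ (proj₁ 0≤x⊖y≤1) (proj₂ 0≤x⊖y≤1)

    ‖x⊖y‖≤1 : ‖ x ⊖ y ‖ ≤ 1#
    ‖x⊖y‖≤1 = ≤-trans (x⊓y≤x (x ⊖ y) (1# - (x ⊖ y))) (proj₂ 0≤x⊖y≤1)

  -- For `y ≤ x` no wrap-around occurs in `x ⊖ y`, so the torus distance is the minimum of `x - y`
  -- and `1 - (x - y)`. Equality can fail, since the other way round the circle may be shorter.
  y≤x⇒‖x⊖y‖+y≤x : ∀ {x y} → y ≤ x → ‖ x ⊖ y ‖ + y ≤ x
  y≤x⇒‖x⊖y‖+y≤x {x} {y} y≤x with x <? y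
  ... | yes x<y = contradiction x<y (≤⇒≯ y≤x)
  ... | no  _   = begin
    ‖ x - y ‖ + y ≤⟨ +-monoˡ-≤ y (x⊓y≤x (x - y) (1# - (x - y))) ⟩
    x - y + y     ≈⟨ x-y+y≈x y x ⟩
    x             ∎

  module SequenceProperties (x : ℕ → Carrier) (x∈[0,1⟩ : ∀ n → In[0,1⟩ (x n)) where
    open Sequence x

    -- The cyclic successor of an index.

    next-inject₁ : ∀ {m} (k : Fin m) → next (inject₁ k) ≡ suc k
    next-inject₁ {m} k = Fin.toℕ-injective
      (≡.trans (Fin.toℕ-fromℕ< _)
      (≡.trans (≡.cong (λ i → suc i ℕ.% suc m) (Fin.toℕ-inject₁ k))
               (ℕ.m<n⇒m%n≡m (s≤s (Fin.toℕ<n k)))))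

    toℕ-next-fromℕ : ∀ m → toℕ (next (Fin.fromℕ m)) ≡ 0
    toℕ-next-fromℕ m =
      ≡.trans (Fin.toℕ-fromℕ< _)
      (≡.trans (≡.cong (λ i → suc i ℕ.% suc m) (Fin.toℕ-fromℕ m)) (ℕ.n%n≡0 (suc m)))

    -- Makes neighbours admissible for `Close`, which demands distinct indices. Two points are
    -- required: on a single point `next` is the identity.
    next≢ : ∀ {m} (k : Fin (2 ℕ.+ m)) → next k ≢ k
    next≢ {m} k eq with view k
    ... | ‵inject₁ j = ℕ.1+n≢n
      (≡.trans (≡.cong toℕ (≡.trans (≡.sym (next-inject₁ j)) eq)) (Fin.toℕ-inject₁ j))
    ... | ‵fromℕ     = contradiction (≡.trans (≡.sym (toℕ-next-fromℕ (suc m))) (≡.cong toℕ eq)) λ ()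

    -- Pairs of close points.

    closePairs : ∀ N → Carrier → List (Fin N × Fin N)
    closePairs N s = filter (close? N s) (cartesianProduct (allFin N) (allFin N))

    closePairs-unique : ∀ N s → Unique (closePairs N s)
    closePairs-unique N s =
      Unique.filter⁺ (close? N s) (Unique.cartesianProduct⁺ (Unique.allFin⁺ N) (Unique.allFin⁺ N))

    ∈-closePairs⁺ : ∀ {N s p} → Close N s p → p ∈ closePairs N s
    ∈-closePairs⁺ {N} {s} {i , j} =
      ∈-filter⁺ (close? N s) (∈-cartesianProduct⁺ (∈-allFin i) (∈-allFin j))

    ∈-closePairs⁻ : ∀ {N s p} → p ∈ closePairs N s → Close N s p
    ∈-closePairs⁻ {N} {s} p∈ =
      proj₂ (∈-filter⁻ (close? N s) {xs = cartesianProduct (allFin N) (allFin N)} p∈)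

    -- Gaps of a given length.

    module _ {N} (σ : Permutation′ N) where
      open Gaps σ using (gap)

      -- At an entry of `G` the length of this list is the multiplicity `φ` by definition. Arbitrary
      -- `ℓ` are allowed so that bounds can be stated uniformly in `ℓ`.
      gapsOfLength : Carrier → List (Fin N)
      gapsOfLength ℓ = filter (λ k → gap k ≟ ℓ) (allFin N)

      ∈-gapsOfLength⁻ : ∀ {ℓ k} → k ∈ gapsOfLength ℓ → gap k ≈ ℓ
      ∈-gapsOfLength⁻ {ℓ} k∈ = proj₂ (∈-filter⁻ (λ k → gap k ≟ ℓ) {xs = allFin N} k∈)

      0≤gap : ∀ k → 0# ≤ gap k
      0≤gap k = 0≤‖x⊖y‖ (x∈[0,1⟩ _) (x∈[0,1⟩ _)

      gap≤1 : ∀ k → gap k ≤ 1#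
      gap≤1 k = ‖x⊖y‖≤1 (x∈[0,1⟩ _) (x∈[0,1⟩ _)

    -- The gaps other than the wrap-around one add up to at most 1 by
    -- telescoping, and the wrap-around gap is itself at most 1.
    multiplicity*ℓ≤2 : ∀ {m} (σ : Permutation′ (suc m)) → Sorts σ → ∀ {ℓ} → 0# ≤ ℓ → ℓ ≤ 1# →
                       fromℕ (length (gapsOfLength σ ℓ)) * ℓ ≤ 1# + 1#
    multiplicity*ℓ≤2 {m} σ sorted {ℓ} 0≤ℓ ℓ≤1 = begin
      fromℕ (length (gapsOfLength σ ℓ)) * ℓ
        ≡⟨ ≡.cong (λ n → fromℕ n * ℓ) (length-filter-allFin (_≟ ℓ) gap) ⟩
      fromℕ (length (filter (_≟ ℓ) (tabulate gap))) * ℓ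
        ≤⟨ *-monoʳ-≤-nonNeg 0≤ℓ (fromℕ-mono-≤ (length-filter-tabulate-inject₁ (_≟ ℓ) m gap)) ⟩
      (1# + c) * ℓ            ≈⟨ solve 2 (λ c ℓ → (con 1 :+ c) :* ℓ := ℓ :+ c :* ℓ) Eq.refl c ℓ ⟩
      ℓ + c * ℓ               ≤⟨ +-monoˡ-≤ (c * ℓ) ℓ≤1 ⟩
      1# + c * ℓ              ≈⟨ +-congˡ (+-identityʳ (c * ℓ)) ⟨
      1# + (c * ℓ + 0#)       ≤⟨ +-monoʳ-≤ 1# (+-monoʳ-≤ (c * ℓ) (proj₁ (x∈[0,1⟩ _))) ⟩
      1# + (c * ℓ + y zero)   ≤⟨ +-monoʳ-≤ 1# (multiplicity*ℓ+y₀≤yₘ ℓ y (gap ∘ inject₁) (0≤gap σ ∘ inject₁) gap+y≤y) ⟩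
      1# + y (Fin.fromℕ m)    ≤⟨ +-monoʳ-≤ 1# (inj₁ (proj₂ (x∈[0,1⟩ _))) ⟩
      1# + 1#                 ∎
      where
      open Gaps σ using (gap)
      y : Fin (suc m) → Carrier
      y k = pt (σ ⟨$⟩ʳ k)
      c = fromℕ (length (filter (_≟ ℓ) (tabulate (gap ∘ inject₁))))
      gap+y≤y : ∀ k → gap (inject₁ k) + y (inject₁ k) ≤ y (suc k)
      gap+y≤y k rewrite next-inject₁ k = y≤x⇒‖x⊖y‖+y≤x
        (sorted (inject₁ k) (suc k) (ℕ.≤-trans (ℕ.≤-reflexive (Fin.toℕ-inject₁ k)) (ℕ.n≤1+n (toℕ k))))

    -- The pairs (σ(k+1), σ(k)) of neighbours at distance exactly ℓ are close at
    -- scale t but not at scale s.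
    closePairs-jump : ∀ {m} (σ : Permutation′ (2 ℕ.+ m)) {s t ℓ} (let N = 2 ℕ.+ m) →
      s /ℕ N ≤ ℓ → ℓ < t /ℕ N →
      length (closePairs N s) ℕ.+ length (gapsOfLength σ ℓ) ℕ.≤ length (closePairs N t)
    -- The left side is the length of a concatenated list, so it is enough that this list has no
    -- repetition and is contained in `closePairs N t`.
    closePairs-jump {m} σ {s} {t} {ℓ} s/N≤ℓ ℓ<t/N = ≡.subst (ℕ._≤ length (closePairs N t))
      (≡.trans (length-++ (closePairs N s))
               (≡.cong (length (closePairs N s) ℕ.+_) (length-map neighbours (gapsOfLength σ ℓ))))
      (Unique∧⊆⇒length≤ unique contained)
      where
      open Gaps σ using (gap)
      N = 2 ℕ.+ m

      s/N<t/N : s /ℕ N < t /ℕ N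
      s/N<t/N = ≤-<-trans s/N≤ℓ ℓ<t/N

      neighbours : Fin N → Fin N × Fin N
      neighbours k = σ ⟨$⟩ʳ next k , σ ⟨$⟩ʳ k

      σ-injective : ∀ {i j} → σ ⟨$⟩ʳ i ≡ σ ⟨$⟩ʳ j → i ≡ j
      σ-injective = Injection.injective (↔⇒↣ σ)

      ∈-neighbours⁻ : ∀ {p} → p ∈ map neighbours (gapsOfLength σ ℓ) →
                      ∃[ k ] (p ≡ neighbours k × gap k ≈ ℓ)
      ∈-neighbours⁻ p∈ with ∈-map⁻ neighbours p∈
      ... | k , k∈ , p≡ = k , p≡ , ∈-gapsOfLength⁻ σ k∈

      disjoint : Disjoint (closePairs N s) (map neighbours (gapsOfLength σ ℓ))
      disjoint (p∈ , p∈′) with ∈-neighbours⁻ p∈′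
      ... | k , ≡.refl , gap≈ℓ =
        ≤⇒≯ s/N≤ℓ (<-respˡ-≈ gap≈ℓ (proj₂ (∈-closePairs⁻ {N} {s} p∈)))

      unique : Unique (closePairs N s ++ map neighbours (gapsOfLength σ ℓ))
      unique = Unique.++⁺ (closePairs-unique N s)
        -- The second coordinate `σ ⟨$⟩ʳ k` alone determines `k`.
        (Unique.map⁺ (σ-injective ∘ ≡.cong proj₂) (Unique.filter⁺ (λ k → gap k ≟ ℓ) (Unique.allFin⁺ N)))
        disjoint

      contained : closePairs N s ++ map neighbours (gapsOfLength σ ℓ) ⊆ closePairs N t
      contained p∈ with ∈-++⁻ (closePairs N s) p∈
      ... | inj₁ p∈s with ∈-closePairs⁻ {N} {s} p∈s
      ...   | i≢j , close = ∈-closePairs⁺ {N} {t} (i≢j , <-trans close s/N<t/N)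
      contained p∈ | inj₂ p∈ℓ with ∈-neighbours⁻ p∈ℓ
      ... | k , ≡.refl , gap≈ℓ =
        ∈-closePairs⁺ {N} {t} (next≢ k ∘ σ-injective , <-respˡ-≈ (Eq.sym gap≈ℓ) ℓ<t/N)

    -- The pair correlation function.

    0≤F : ∀ {N} s → 0 ℕ.< N → 0# ≤ F N s
    0≤F {N} s 0<N = begin
      0#            ≈⟨ zeroˡ (fromℕ N ⁻¹) ⟨
      0# /ℕ N       ≤⟨ *-monoʳ-≤-nonNeg (inj₁ (⁻¹-positive (0<fromℕ 0<N))) (0≤fromℕ (length (closePairs N s))) ⟩
      F N s         ∎

    -- `closePairs-jump` divided by `N`: at least `ε N` additional pairs raise `F` by at least `ε`.
    F-jump : ∀ {m} (σ : Permutation′ (2 ℕ.+ m)) {s t ℓ ε} (let N = 2 ℕ.+ m) →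
             s /ℕ N ≤ ℓ → ℓ < t /ℕ N → ε * fromℕ N ≤ fromℕ (length (gapsOfLength σ ℓ)) →
             F N s + ε ≤ F N t
    F-jump {m} σ {s} {t} {ℓ} {ε} s/N≤ℓ ℓ<t/N εN≤c = begin
      a /ℕ N + ε                 ≈⟨ +-congˡ (x*y*y⁻¹≈x ε 0<N) ⟨
      a /ℕ N + ε * fromℕ N /ℕ N  ≈⟨ distribʳ (fromℕ N ⁻¹) a (ε * fromℕ N) ⟨
      (a + ε * fromℕ N) /ℕ N     ≤⟨ *-monoʳ-≤-nonNeg (inj₁ (⁻¹-positive 0<N)) a+εN≤b ⟩
      F N t                      ∎
      where
      N = 2 ℕ.+ m
      a = fromℕ (length (closePairs N s))
      0<N : 0# < fromℕ N
      0<N = 0<fromℕ {2 ℕ.+ m} (s≤s z≤n)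
      a+εN≤b : a + ε * fromℕ N ≤ fromℕ (length (closePairs N t))
      a+εN≤b = begin
        a + ε * fromℕ N                         ≤⟨ +-monoʳ-≤ a εN≤c ⟩
        a + fromℕ (length (gapsOfLength σ ℓ))   ≈⟨ fromℕ-homo-+ (length (closePairs N s)) _ ⟨
        fromℕ (length (closePairs N s) ℕ.+ length (gapsOfLength σ ℓ))
          ≤⟨ fromℕ-mono-≤ (closePairs-jump σ s/N≤ℓ ℓ<t/N) ⟩
        fromℕ (length (closePairs N t))         ∎

    -- Consequences of Poissonian pair correlations.

    module _ (ppc : PoissonianPairCorrelations) where

      module _ {δ} (0<δ : 0# < δ) where

        -- The upper estimate is used at the right endpoint of a grid interval, which is positive
        -- for every `j`, so the limit hypothesis applies directly.
        eventually-F-upper : ∀ j → ∃[ N ] (∀ n → N ℕ.≤ n →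
          F n (fromℕ (suc j) * δ) < δ + fromℕ 2 * (fromℕ (suc j) * δ))
        eventually-F-upper j with ppc (fromℕ (suc j) * δ) (*-positive (0<fromℕ {suc j} (s≤s z≤n)) 0<δ) δ 0<δ
        ... | N , close = N , λ n N≤n → ∣x-y∣<ε⇒x<ε+y (close n N≤n)

        eventually-F-lower : ∀ j → ∃[ N ] (∀ n → N ℕ.≤ n →
          fromℕ 2 * (fromℕ j * δ) < δ + F n (fromℕ j * δ))
        -- The limit hypothesis is silent at `s = 0`; there nonnegativity of `F` gives the bound,
        -- from `n = 1` on.
        eventually-F-lower zero = 1 , λ n 0<n → begin-strict
          fromℕ 2 * (0# * δ)  ≈⟨ *-congˡ (zeroˡ δ) ⟩
          fromℕ 2 * 0#        ≈⟨ zeroʳ (fromℕ 2) ⟩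
          0#                  <⟨ 0<δ ⟩
          δ                   ≈⟨ +-identityʳ δ ⟨
          δ + 0#              ≤⟨ +-monoʳ-≤ δ (0≤F (0# * δ) 0<n) ⟩
          δ + F n (0# * δ)    ∎
        eventually-F-lower (suc j) with ppc (fromℕ (suc j) * δ) (*-positive (0<fromℕ {suc j} (s≤s z≤n)) 0<δ) δ 0<δ
        ... | N , close = N , λ n N≤n → ∣x-y∣<ε⇒y<ε+x (close n N≤n)

      module _ (σ : ∀ n → Permutation′ n) (sorted : ∀ n → 2 ℕ.≤ n → Sorts (σ n)) where

        -- The threshold must not depend on `ℓ`, since the frequent length may change with `n`. The
        -- finite grid of points `j δ` makes this possible: the same finitely many limits serve
        -- every `ℓ`.
        few-gaps-of-equal-length : ∀ ε → 0# < ε → ∃[ N ] (∀ n → N ℕ.≤ n →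
          2 ℕ.≤ n × (∀ ℓ → fromℕ (length (gapsOfLength (σ n) ℓ)) < ε * fromℕ n))
        few-gaps-of-equal-length ε 0<ε = 2 ℕ.⊔ (N₁ ℕ.⊔ N₂) , bound
          where
          -- Over a step `δ` the limit `2 s` grows by `2 δ`, and the two approximations of `F` cost
          -- `δ` each, in total `4 δ = ε`.
          δ = ε * fromℕ 4 ⁻¹
          0<δ : 0# < δ
          0<δ = *-positive 0<ε (⁻¹-positive (0<fromℕ {4} (s≤s z≤n)))
          δ4≈ε : δ * fromℕ 4 ≈ ε
          δ4≈ε = x*y⁻¹*y≈x ε (0<fromℕ {4} (s≤s z≤n))
          0<εδ = *-positive 0<ε 0<δ

          -- `K δ` exceeds `2 / ε`, an upper bound for `n ℓ` whenever at least `ε n` gaps have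
          -- length `ℓ`.
          K = proj₁ (archimedean ((1# + 1#) * (ε * δ) ⁻¹))
          2<Kεδ : 1# + 1# < fromℕ K * (ε * δ)
          2<Kεδ = <-respˡ-≈ (x*y⁻¹*y≈x (1# + 1#) 0<εδ)
            (*-monoʳ-<-pos 0<εδ (proj₂ (archimedean ((1# + 1#) * (ε * δ) ⁻¹))))

          N₁ = proj₁ (eventually-∀< (eventually-F-upper 0<δ) K)
          N₂ = proj₁ (eventually-∀< (eventually-F-lower 0<δ) K)

          bound : ∀ n → 2 ℕ.⊔ (N₁ ℕ.⊔ N₂) ℕ.≤ n →
            2 ℕ.≤ n × (∀ ℓ → fromℕ (length (gapsOfLength (σ n) ℓ)) < ε * fromℕ n)
          -- `F-jump` concerns `2 ℕ.+ m` points, so `n` is split until it has this form.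
          bound n N≤n with ℕ.≤-trans (ℕ.m≤m⊔n 2 (N₁ ℕ.⊔ N₂)) N≤n
          bound zero            N≤n | ()
          bound (suc zero)      N≤n | s≤s ()
          bound n@(suc (suc m)) N≤n | 2≤n = 2≤n , few
            where
            N₁⊔N₂≤n = ℕ.≤-trans (ℕ.m≤n⊔m 2 (N₁ ℕ.⊔ N₂)) N≤n
            F-upper = proj₂ (eventually-∀< (eventually-F-upper 0<δ) K) n
              (ℕ.≤-trans (ℕ.m≤m⊔n N₁ N₂) N₁⊔N₂≤n)
            F-lower = proj₂ (eventually-∀< (eventually-F-lower 0<δ) K) n
              (ℕ.≤-trans (ℕ.m≤n⊔m N₁ N₂) N₁⊔N₂≤n)

            0<n : 0# < fromℕ n
            0<n = 0<fromℕ {n} (s≤s z≤n)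

            module _ (ℓ : Carrier) where
              gaps = gapsOfLength (σ n) ℓ

              s/n : ℕ → Carrier
              s/n j = fromℕ j * δ /ℕ n

              module _ (εn≤#gaps : ε * fromℕ n ≤ fromℕ (length gaps)) where

                -- Since `ε n` is positive, some gap does have length `ℓ`; this is what places `ℓ`
                -- in `[0, 1]`.
                gaps-nonempty : ∃ (_∈ gaps)
                gaps-nonempty = ∈-length-positive (ℕ.≰⇒> λ #gaps≤0 →
                  ≤⇒≯ (≤-trans εn≤#gaps (fromℕ-mono-≤ #gaps≤0)) (*-positive 0<ε 0<n))

                gap≈ℓ : Gaps.gap (σ n) (proj₁ gaps-nonempty) ≈ ℓ
                gap≈ℓ = ∈-gapsOfLength⁻ (σ n) (proj₂ gaps-nonempty)

                0≤ℓ : 0# ≤ ℓ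
                0≤ℓ = ≤-trans (0≤gap (σ n) _) (inj₂ gap≈ℓ)

                ℓ≤1 : ℓ ≤ 1#
                ℓ≤1 = ≤-trans (inj₂ (Eq.sym gap≈ℓ)) (gap≤1 (σ n) _)

                ℓ≮s₀/n : ¬ (ℓ < s/n 0)
                ℓ≮s₀/n = ≤⇒≯ (begin
                  0# * δ /ℕ n ≈⟨ *-congʳ (zeroˡ δ) ⟩
                  0# /ℕ n     ≈⟨ zeroˡ (fromℕ n ⁻¹) ⟩
                  0#          ≤⟨ 0≤ℓ ⟩
                  ℓ           ∎)

                -- Multiplying `j δ / n ≤ ℓ` by `ε n` gives `j ε δ ≤ ε n ℓ`, which is at most the
                -- total length of the gaps equal to `ℓ`, hence at most 2.
                s/n≤ℓ⇒jεδ≤2 : ∀ {j} → s/n j ≤ ℓ → fromℕ j * (ε * δ) ≤ 1# + 1#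
                s/n≤ℓ⇒jεδ≤2 {j} s/n≤ℓ = begin
                  fromℕ j * (ε * δ)                   ≈⟨ x*y*y⁻¹≈x (fromℕ j * (ε * δ)) 0<n ⟨
                  fromℕ j * (ε * δ) * fromℕ n /ℕ n
                    ≈⟨ solve 5 (λ j ε δ n n⁻¹ → j :* (ε :* δ) :* n :* n⁻¹ := ε :* n :* (j :* δ :* n⁻¹))
                         Eq.refl (fromℕ j) ε δ (fromℕ n) (fromℕ n ⁻¹) ⟩
                  ε * fromℕ n * s/n j                 ≤⟨ *-monoˡ-≤-nonNeg (inj₁ (*-positive 0<ε 0<n)) s/n≤ℓ ⟩
                  ε * fromℕ n * ℓ                     ≤⟨ *-monoʳ-≤-nonNeg 0≤ℓ εn≤#gaps ⟩
                  fromℕ (length gaps) * ℓ             ≤⟨ multiplicity*ℓ≤2 (σ n) (sorted n 2≤n) 0≤ℓ ℓ≤1 ⟩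
                  1# + 1#                             ∎

                ℓ<sK/n : ℓ < s/n K
                ℓ<sK/n = ≰⇒> λ sK/n≤ℓ → ≤⇒≯ (s/n≤ℓ⇒jεδ≤2 {K} sK/n≤ℓ) 2<Kεδ

                no-jump : ∀ j → j ℕ.< K → s/n j ≤ ℓ → ¬ (ℓ < s/n (suc j))
                -- The chain returns to its starting value, `δ + (δ + 2 (j + 1) δ)` being
                -- `2 j δ + 4 δ`, so its strict steps are contradictory.
                no-jump j j<K sⱼ/n≤ℓ ℓ<s₁₊ⱼ/n = <-irrefl Eq.refl (begin-strict
                  2sⱼ + ε
                    <⟨ +-monoˡ-< ε (F-lower j j<K) ⟩
                  (δ + F n (fromℕ j * δ)) + ε
                    ≈⟨ +-assoc δ (F n (fromℕ j * δ)) ε ⟩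
                  δ + (F n (fromℕ j * δ) + ε)
                    ≤⟨ +-monoʳ-≤ δ (F-jump (σ n) sⱼ/n≤ℓ ℓ<s₁₊ⱼ/n εn≤#gaps) ⟩
                  δ + F n (fromℕ (suc j) * δ)
                    <⟨ +-monoʳ-< δ (F-upper j j<K) ⟩
                  δ + (δ + fromℕ 2 * (fromℕ (suc j) * δ))
                    ≈⟨ solve 2 (λ j δ → δ :+ (δ :+ ℕ2 :* ((con 1 :+ j) :* δ)) := ℕ2 :* (j :* δ) :+ δ :* ℕ4)
                         Eq.refl (fromℕ j) δ ⟩
                  2sⱼ + δ * fromℕ 4
                    ≈⟨ +-congˡ δ4≈ε ⟩
                  2sⱼ + ε ∎)
                  where
                  2sⱼ = fromℕ 2 * (fromℕ j * δ)
                  ℕ2 = con 1 :+ (con 1 :+ con 0)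
                  ℕ4 = con 1 :+ (con 1 :+ ℕ2)

              few : fromℕ (length gaps) < ε * fromℕ n
              few = ≰⇒> λ εn≤#gaps →
                -- The grid point 0 does not exceed `n ℓ` and `K δ` does, so `n ℓ` falls between two
                -- consecutive grid points.
                let j , j<K , ℓ≮sⱼ/n , ℓ<s₁₊ⱼ/n =
                      first-step (λ j → ℓ <? s/n j) K (ℓ≮s₀/n εn≤#gaps) (ℓ<sK/n εn≤#gaps)
                in no-jump εn≤#gaps j j<K (≮⇒≥ ℓ≮sⱼ/n) ℓ<s₁₊ⱼ/n

        -- The two forms of the little-o statement.

        maxφ=o[n] : (λ n → Gaps.maxφ (σ n)) =o[n]
        maxφ=o[n] ε 0<ε with few-gaps-of-equal-length ε 0<ε
        ... | N , few = N , λ n N≤n → small n (few n N≤n)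
          where
          small : ∀ n → 2 ℕ.≤ n × (∀ ℓ → fromℕ (length (gapsOfLength (σ n) ℓ)) < ε * fromℕ n) →
                  ∣ fromℕ (Gaps.maxφ (σ n)) /ℕ n - 0# ∣ < ε
          small n (2≤n , φ<εn) = 0≤x<ε⇒∣x-0∣<ε
            (begin
              0#                         ≈⟨ zeroˡ (fromℕ n ⁻¹) ⟨
              0# /ℕ n                    ≤⟨ *-monoʳ-≤-nonNeg (inj₁ 0<n⁻¹) (0≤fromℕ maxφ) ⟩
              fromℕ maxφ /ℕ n            ∎)
            (begin-strict
              fromℕ maxφ /ℕ n            <⟨ *-monoʳ-<-pos 0<n⁻¹ maxφ<εn ⟩
              ε * fromℕ n /ℕ n           ≈⟨ x*y*y⁻¹≈x ε 0<n ⟩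
              ε                          ∎)
            where
            open Gaps (σ n) using (maxφ; φ; g; ℓ)
            0<n : 0# < fromℕ n
            0<n = 0<fromℕ (ℕ.≤-trans (s≤s z≤n) 2≤n)
            0<n⁻¹ = ⁻¹-positive 0<n
            maxφ<εn : fromℕ maxφ < ε * fromℕ n
            -- The maximum is taken with default value 0, so the bound is needed for 0 as well,
            -- where it reads `0 < ε n`.
            maxφ<εn = argmax-all id {P = λ m → fromℕ m < ε * fromℕ n} (*-positive 0<ε 0<n)
              (All.map⁺ {xs = allFin g} (All.tabulate λ {i} _ → φ<εn (ℓ i)))

        -- The uniform bound with `ε = c` and threshold `N` is contradicted at the index `ν N`,
        -- which is at least `N` because `ν` is strictly increasing.
        no-positive-proportion : ¬ (Σ[ ν ∈ (ℕ → ℕ) ] Σ[ c ∈ Carrier ]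
          ((∀ t → 2 ℕ.≤ ν t)
          × (ν Preserves ℕ._<_ ⟶ ℕ._<_)
          × (0# < c)
          × (∀ t → ∃[ i ] c * fromℕ (ν t) ≤ fromℕ (Gaps.φ (σ (ν t)) i))))
        no-positive-proportion (ν , c , _ , ν-mono , 0<c , large) with few-gaps-of-equal-length c 0<c
        ... | N , few with large N
        ...   | i , cν≤φ = ≤⇒≯ cν≤φ
          (proj₂ (few (ν N) (strictlyMonotone⇒expansive ν-mono N)) (Gaps.ℓ (σ (ν N)) i))

open import Data.Nat.Base using (_≤_; _<_)

theorem1p2 : (ℝ : Reals) (x : ℕ → Reals.Carrier ℝ) →
    (∀ n → Torus.In[0,1⟩ ℝ (x n)) →
    Torus.Sequence.PoissonianPairCorrelations ℝ x →
    (σ : ∀ n → Permutation′ n) →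
    (∀ n → 2 ≤ n → Torus.Sequence.Sorts ℝ x (σ n)) →
    (Reals._=o[n] ℝ (λ n → Torus.Sequence.Gaps.maxφ ℝ x (σ n)))
    × ¬ (Σ[ ν ∈ (ℕ → ℕ) ] Σ[ c ∈ Reals.Carrier ℝ ]
    ((∀ t → 2 ≤ ν t)
    × (ν Preserves _<_ ⟶ _<_)
    × (Reals._<_ ℝ (Reals.0# ℝ) c)
    × (∀ t → ∃[ i ] Reals._≤_ ℝ (Reals._*_ ℝ c (Reals.fromℕ ℝ (ν t)))
    (Reals.fromℕ ℝ (Torus.Sequence.Gaps.φ ℝ x (σ (ν t)) i)))))
theorem1p2 ℝ x x∈ ppc σ sorted = maxφ=o[n] ppc σ sorted , no-positive-proportion ppc σ sorted
  where open Properties.SequenceProperties ℝ x x∈
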